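{- There exists a constant $c > 0$ such that $$\Psi(r) \ge 2^{r-1} + c\, r\, 2^{r/2}$$ for all sufficiently large $r$.
   Context: For a finite connected graph $G=(V,E)$, its cyclomatic number is $r(G)=|E|-|V|+1$. $\Psi(r)$ denotes the maximum number of cycles (counted as subgraphs) in a connected graph $G$ with cyclomatic number $r(G)=r$; it is finite because the number of cycles in $G$ is at most $2^{r(G)}-1$. -}

module Defs where

open import Data.Fin.Base using (Fin; toℕ) renaming (_<_ to _<ᶠ_)
open import Data.Fin.Properties using (any?; all?; injective⇒≤) renaming (_≟_ to _≟ᶠ_)
open import Data.Fin.Subset using (Subset; _∈_; inside; outside)
open import Data.Fin.Subset.Properties using (_∈?_)
open import Data.Integer.Base using (ℤ; +_; 1ℤ) renaming (_+_ to _+ℤ_; _-_ to _-ℤ_)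
open import Data.List.Base using (List; []; _∷_; _++_; map; filter; length)
open import Data.Nat.Base using (ℕ; zero; suc; _≤_; _^_; s≤s; NonZero)
open import Data.Nat.DivMod using (_mod_)
open import Data.Nat.Properties using (_≤?_; anyUpTo?)
open import Data.Product using (Σ; ∃; ∃-syntax; _×_; _,_; proj₁; proj₂)
open import Data.Product.Properties using (≡-dec)
open import Data.Rational.Base using (ℚ; 0ℚ; _/_) renaming (_*_ to _*ℚ_; _<_ to _<ℚ_)
open import Data.Sum.Base using (_⊎_)
open import Data.Vec.Base using (Vec; []; _∷_; lookup)
open import Function.Bundles using (_⇔_; mk⇔; Equivalence)
open import Function.Definitions using (Injective)
open import Relation.Binary.Construct.Closure.ReflexiveTransitive using (Star)
open import Relation.Binary.PropositionalEquality using (_≡_)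
open import Relation.Nullary using (Dec)
open import Relation.Nullary.Decidable using (map′; _×-dec_; _⊎-dec_; _→-dec_)

-- A finite simple graph with vertex set Fin order. Its edge set is enumerated
-- without repetition by Fin size, each edge {u , w} being listed as the pair
-- (u , w) with u < w; thus loops and parallel edges are excluded.
record Graph : Set where
  field
    order    : ℕ
    size     : ℕ
    ends     : Fin size → Fin order × Fin order
    ordered  : ∀ e → proj₁ (ends e) <ᶠ proj₂ (ends e)
    distinct : Injective _≡_ _≡_ ends

  Vertex : Set
  Vertex = Fin order

  Edge : Set
  Edge = Fin size

  Joins : Edge → Vertex → Vertex → Set
  Joins e u w = ends e ≡ (u , w) ⊎ ends e ≡ (w , u)

  Adjacent : Vertex → Vertex → Set
  Adjacent u w = ∃[ e ] Joins e u w

open Graph public using (order; size)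

Connected : Graph → Set
Connected G = NonZero (order G) × (∀ u w → Star (Graph.Adjacent G) u w)

cyclomatic : Graph → ℤ
cyclomatic G = (+ size G -ℤ + order G) +ℤ 1ℤ

next : ∀ {k} → Fin k → Fin k
next {suc k} i = suc (toℕ i) mod suc k

module _ (G : Graph) where
  open Graph G using (Vertex; Edge; Joins; Adjacent; ends)

  -- F is the edge set of the cycle v₀ v₁ … vₖ₋₁ v₀.
  IsCycleAlong : ∀ {k} → Vec Vertex k → Subset (size G) → Set
  IsCycleAlong {k} v F =
      3 ≤ k
    × Injective _≡_ _≡_ (lookup v)
    × (∀ i → Adjacent (lookup v i) (lookup v (next i)))
    × (∀ e → e ∈ F ⇔ (∃[ i ] Joins e (lookup v i) (lookup v (next i))))

  -- A cycle, as a subgraph, is determined by its edge set.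
  IsCycle : Subset (size G) → Set
  IsCycle F = ∃[ k ] Σ (Vec Vertex k) λ v → IsCycleAlong v F

  joins? : ∀ e u w → Dec (Joins e u w)
  joins? e u w = (ends e ≟ (u , w)) ⊎-dec (ends e ≟ (w , u))
    where _≟_ = ≡-dec _≟ᶠ_ _≟ᶠ_

  isCycleAlong? : ∀ {k} (v : Vec Vertex k) F → Dec (IsCycleAlong v F)
  isCycleAlong? {k} v F =
          (3 ≤? k)
    ×-dec map′ (λ f {i} {j} → f i j) (λ f i j → f {i} {j})
            (all? λ i → all? λ j → (lookup v i ≟ᶠ lookup v j) →-dec (i ≟ᶠ j))
    ×-dec all? (λ i → any? λ e → joins? e (lookup v i) (lookup v (next i)))
    ×-dec all? (λ e → (e ∈? F) ⇔-dec
                      any? λ i → joins? e (lookup v i) (lookup v (next i)))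
    where
    _⇔-dec_ : ∀ {A B : Set} → Dec A → Dec B → Dec (A ⇔ B)
    a? ⇔-dec b? = map′ (λ (f , g) → mk⇔ f g)
                       (λ h → Equivalence.to h , Equivalence.from h)
                       ((a? →-dec b?) ×-dec (b? →-dec a?))

  anyVec? : ∀ {n} k {P : Vec (Fin n) k → Set} → (∀ v → Dec (P v)) → Dec (∃ P)
  anyVec? zero    P? = map′ ([] ,_) (λ { ([] , p) → p }) (P? [])
  anyVec? (suc k) P? =
    map′ (λ (x , v , p) → x ∷ v , p) (λ { (x ∷ v , p) → x , v , p })
         (any? λ x → anyVec? k λ v → P? (x ∷ v))

  isCycle? : ∀ F → Dec (IsCycle F)
  isCycle? F =
    map′ (λ (k , _ , c) → k , c)
         (λ (k , v , c) → k , s≤s (injective⇒≤ (proj₁ (proj₂ c))) , v , c)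
         (anyUpTo? (λ k → anyVec? k λ v → isCycleAlong? v F) (suc (order G)))

allSubsets : ∀ n → List (Subset n)
allSubsets zero    = [] ∷ []
allSubsets (suc n) = map (outside ∷_) (allSubsets n) ++ map (inside ∷_) (allSubsets n)

numCycles : Graph → ℕ
numCycles G = length (filter (isCycle? G) (allSubsets (size G)))

-- IsΨ r m says that Ψ(r) = m. Ψ is a relation rather than a function because
-- its maximum ranges over infinitely many graphs (whose numbers of cycles are
-- all at most 2 ^ r - 1).
record IsΨ (r m : ℕ) : Set where
  field
    attained : ∃[ G ] Connected G × cyclomatic G ≡ + r × numCycles G ≡ m
    maximal  : ∀ G → Connected G → cyclomatic G ≡ + r → numCycles G ≤ m

fromℕ : ℕ → ℚ
fromℕ n = + n / 1

-- The lower Dedekind cut of the real number 2^(r/2) = √(2^r). For rational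
-- a, b ≥ 0 and d, the real inequality a + b · 2^(r/2) ≤ d means that
-- a + b · q ≤ d for every rational q in this cut.
_<2^[_/2] : ℚ → ℕ → Set
q <2^[ r /2] = q <ℚ 0ℚ ⊎ q *ℚ q <ℚ fromℕ (2 ^ r)

{-# OPTIONS --safe #-}

-- Arrange n + 1 gadgets in a ring, each with two left and two right corners, and
-- join the right corners of every gadget to the left corners of the next one by
-- two links. Gadget 0 is a ladder with one or two rungs (according to the parity
-- of r), every other gadget is the complete bipartite graph between its left and
-- its right corners; the cyclomatic number r is then 2n + 2 or 2n + 3.
--
-- Cycles that wind once round the ring leave each gadget through one of its two
-- right corners, and cross each gadget other than gadget 0 in one of two ways,
-- whichever corners are prescribed; gadget 0 offers as many ways as it has
-- rungs. This gives exactly 2^(r-1) cycles.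
--
-- Further cycles arise by choosing a pair of consecutive gadgets and omitting the
-- two links between them: two disjoint strands run through the remainder of the
-- ring and are joined in the gadgets at both ends. Every complete bipartite gadget
-- allows two ways to cross it (straight or crossed), or to close it at an end,
-- while gadget 0 is passed in a single way. Each of the n gaps considered thus
-- contributes 2^n cycles, and n 2^n is of order r 2^(r/2).

module Submission where

open import Defs
open import Data.Bool.Base using (Bool; true; false; not; _xor_)
open import Data.Bool.Properties using (not-¬; ¬-not; not-involutive) renaming (_≟_ to _≟ᵇ_)
open import Data.Empty using (⊥; ⊥-elim)
open import Data.Fin.Base using (Fin; zero; suc; toℕ; inject₁) renaming (fromℕ to maxᶠ)
open import Data.Fin.Induction using (<-weakInduction)
open import Data.Fin.Properties
  using (_<?_; <-cmp; injective⇒≤; toℕ-injective; toℕ-fromℕ<; toℕ-fromℕ; toℕ-inject₁; toℕ<n;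
         0≢1+n; suc-injective; 2↔Bool; *↔×; +↔⊎)
  renaming (_≟_ to _≟ᶠ_)
open import Data.Fin.Relation.Unary.Top using (view; ‵fromℕ; ‵inject₁)
open import Data.Fin.Subset using (Subset; inside; outside) renaming (_∈_ to _∈ˢ_)
open import Data.Integer.Base using (+_; +≤+; 1ℤ)
  renaming (_+_ to _+ℤ_; _-_ to _-ℤ_; _≤_ to _≤ℤ_)
import Data.Integer.Properties as ℤ
import Data.Integer.Solver as ℤ-Solver
open import Data.List.Base using (List; []; _∷_; _++_; [_]; length; filter; allFin; tabulate)
  renaming (lookup to lookupˡ)
import Data.List.Membership.DecPropositional as DecMembership
open import Data.List.Membership.Propositional using (_∈_; _∉_)
open import Data.List.Membership.Propositional.Properties
  using (∈-filter⁺; ∈-++⁺ˡ; ∈-++⁺ʳ; ∈-map⁺; ∈-allFin; ∈-∃++)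
open import Data.List.Properties using (length-++)
open import Data.List.Relation.Binary.Permutation.Propositional using (_↭_; ↭⇒↭ₛ)
open import Data.List.Relation.Binary.Permutation.Propositional.Properties using (++-comm; ∈-resp-↭)
open import Data.List.Relation.Binary.Permutation.Setoid.Properties using (Unique-resp-↭)
open import Data.List.Relation.Unary.All using (All; []; _∷_) renaming (map to mapᴬ; lookup to lookupᴬ)
open import Data.List.Relation.Unary.All.Properties using (++⁺; All¬⇒¬Any)
open import Data.List.Relation.Unary.AllPairs using ([]; _∷_)
open import Data.List.Relation.Unary.Any using (here; there; index)
open import Data.List.Relation.Unary.Any.Properties using (lookup-index)
open import Data.List.Relation.Unary.Unique.Propositional using (Unique)
import Data.List.Relation.Unary.Unique.Propositional.Properties as Unique
open import Data.Nat.Base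
  using (ℕ; zero; suc; _+_; _*_; _∸_; _^_; _/_; _%_; _≤_; _<_; z≤n; s≤s)
open import Data.Nat.Coprimality using (1-coprimeTo) renaming (sym to coprime-sym)
open import Data.Nat.DivMod using (m<n⇒m%n≡m; n%n≡0; m%n<n; m≡m%n+[m/n]*n)
open import Data.Nat.Properties
  using (≤-refl; ≤-trans; ≤-pred; <-irrefl; <-asym; n≤1+n; 1+n≢n; m≤m+n; m≤n+m; m+[n∸m]≡n;
         +-suc; +-mono-≤; +-monoˡ-≤; +-monoʳ-≤; *-comm; *-distribˡ-+; *-monoˡ-≤; *-monoʳ-≤;
         ^-monoʳ-≤; ^-distribˡ-+-*; ^-*-assoc; module ≤-Reasoning)
open import Data.Nat.Solver using (module +-*-Solver)
open import Data.Product as Product using (_×_; _,_; proj₁; proj₂; swap; uncurry; ∃-syntax)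
open import Data.Product.Function.NonDependent.Propositional using (_×-↔_)
open import Data.Rational.Base using (ℚ; 0ℚ; 1ℚ; mkℚ; *≤*; nonNegative)
  renaming (_+_ to _+ℚ_; _*_ to _*ℚ_; _<_ to _<ℚ_; _≤_ to _≤ℚ_; _/_ to _/ℚ_;
            NonNegative to NonNegativeℚ)
import Data.Rational.Properties as ℚ
open import Data.Sum.Base as Sum using (_⊎_; inj₁; inj₂)
open import Data.Sum.Function.Propositional using (_⊎-↔_)
open import Data.Unit.Base using (⊤; tt)
open import Data.Vec.Base using (Vec; []; _∷_; fromList; lookup; uncons)
  renaming (map to mapᵛ; tabulate to tabulateᵛ)
open import Data.Vec.Properties using (lookup-map; lookup∘tabulate; []=⇒lookup; lookup⇒[]=)
open import Data.Vec.Relation.Binary.Pointwise.Extensional using (ext; extensional⇒inductive)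
open import Data.Vec.Relation.Binary.Pointwise.Inductive using (Pointwise-≡⇒≡)
open import Function.Base using (_∘_; id)
open import Function.Bundles using (_↔_; _⇔_; mk↔ₛ′; mk⇔; Inverse; Equivalence)
open import Function.Definitions using (Injective)
open import Function.Properties.Inverse using (↔-trans; ↔-refl)
open import Relation.Binary.Construct.Closure.ReflexiveTransitive
  using (Star; ε; _◅_; _◅◅_; gmap; reverse)
open import Relation.Binary.Definitions using (DecidableEquality; tri<; tri≈; tri>)
open import Relation.Binary.PropositionalEquality
  using (_≡_; _≢_; refl; sym; trans; cong; cong₂; subst; subst₂; setoid; module ≡-Reasoning)
open import Relation.Nullary using (yes; no; does)
open import Relation.Nullary.Decidable using (dec-true; map′)

-- Lower bounds for the number of cycles.

∈-allSubsets : ∀ {n} (F : Subset n) → F ∈ allSubsets n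
∈-allSubsets []            = here refl
∈-allSubsets (outside ∷ F) = ∈-++⁺ˡ (∈-map⁺ (outside ∷_) (∈-allSubsets F))
∈-allSubsets (inside ∷ F)  = ∈-++⁺ʳ _ (∈-map⁺ (inside ∷_) (∈-allSubsets F))

-- The position of `f i` in the list of cycles determines `f i` by lookup, hence `i`; so `Fin N`
-- injects into the positions, of which there are `numCycles G`.
injective⇒≤numCycles : ∀ G {N} (f : Fin N → Subset (size G)) → Injective _≡_ _≡_ f →
  (∀ i → IsCycle G (f i)) → N ≤ numCycles G
injective⇒≤numCycles G f f-injective f-cycle = injective⇒≤ position-injective
  where
  cycles = filter (isCycle? G) (allSubsets (size G))

  listed : ∀ i → f i ∈ cycles
  listed i = ∈-filter⁺ (isCycle? G) (∈-allSubsets (f i)) (f-cycle i)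

  position-injective : Injective _≡_ _≡_ (index ∘ listed)
  position-injective {i} {j} eq = f-injective
    (trans (lookup-index (listed i))
      (trans (cong (lookupˡ cycles) eq) (sym (lookup-index (listed j)))))

-- The cyclic successor.

toℕ-next : ∀ {k} (i : Fin (suc k)) → toℕ (next i) ≡ suc (toℕ i) % suc k
toℕ-next i = toℕ-fromℕ< (m%n<n (suc (toℕ i)) _)

next-inject₁ : ∀ {k} (i : Fin k) → next (inject₁ i) ≡ suc i
next-inject₁ {k} i = toℕ-injective (trans (toℕ-next (inject₁ i))
  (trans (cong (λ x → suc x % suc k) (toℕ-inject₁ i)) (m<n⇒m%n≡m (s≤s (toℕ<n i)))))

next-max : ∀ k → next (maxᶠ k) ≡ zero
next-max k = toℕ-injective (trans (toℕ-next (maxᶠ k))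
  (trans (cong (λ x → suc x % suc k) (toℕ-fromℕ k)) (n%n≡0 (suc k))))

-- Unordered pairs and lists without repetition.

orient : ∀ {n} → Fin n × Fin n → Fin n × Fin n
orient (u , w) with u <? w
... | yes _ = u , w
... | no  _ = w , u

orient-cases : ∀ {n} (p : Fin n × Fin n) → orient p ≡ p ⊎ orient p ≡ swap p
orient-cases (u , w) with u <? w
... | yes _ = inj₁ refl
... | no  _ = inj₂ refl

orient-ordered : ∀ {n} (p : Fin n × Fin n) → proj₁ p ≢ proj₂ p →
  toℕ (proj₁ (orient p)) < toℕ (proj₂ (orient p))
orient-ordered (u , w) u≢w with u <? w
... | yes u<w = u<w
... | no  u≮w with <-cmp u w
...   | tri< u<w _ _ = ⊥-elim (u≮w u<w)
...   | tri≈ _ u≡w _ = ⊥-elim (u≢w u≡w)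
...   | tri> _ _ w<u = w<u

-- Equality of unordered pairs, in the form to which `Joins` unfolds: `Joins e u w` is
-- definitionally `ends e ≈ₚ (u , w)`.
_≈ₚ_ : ∀ {A : Set} → A × A → A × A → Set
p ≈ₚ p′ = p ≡ p′ ⊎ p ≡ swap p′

≈ₚ-sym : ∀ {A : Set} {p p′ : A × A} → p ≈ₚ p′ → p′ ≈ₚ p
≈ₚ-sym (inj₁ refl) = inj₁ refl
≈ₚ-sym (inj₂ refl) = inj₂ refl

≈ₚ-trans : ∀ {A : Set} {p p′ p″ : A × A} → p ≈ₚ p′ → p′ ≈ₚ p″ → p ≈ₚ p″
≈ₚ-trans (inj₁ refl) q           = q
≈ₚ-trans (inj₂ refl) (inj₁ refl) = inj₂ refl
≈ₚ-trans (inj₂ refl) (inj₂ refl) = inj₁ refl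

≈ₚ-map : ∀ {A B : Set} (f : A → B) {p p′ : A × A} → p ≈ₚ p′ → Product.map f f p ≈ₚ Product.map f f p′
≈ₚ-map f (inj₁ refl) = inj₁ refl
≈ₚ-map f (inj₂ refl) = inj₂ refl

≈ₚ-map⁻ : ∀ {A B : Set} {f : A → B} → Injective _≡_ _≡_ f → ∀ {p p′ : A × A} →
  Product.map f f p ≈ₚ Product.map f f p′ → p ≈ₚ p′
≈ₚ-map⁻ f-injective (inj₁ eq) = inj₁ (cong₂ _,_ (f-injective (cong proj₁ eq)) (f-injective (cong proj₂ eq)))
≈ₚ-map⁻ f-injective (inj₂ eq) = inj₂ (cong₂ _,_ (f-injective (cong proj₁ eq)) (f-injective (cong proj₂ eq)))

lookup-fromList-All : ∀ {A : Set} {P : A → Set} {xs} → All P xs → ∀ i → P (lookup (fromList xs) i)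
lookup-fromList-All (p ∷ _)  zero    = p
lookup-fromList-All (_ ∷ ps) (suc i) = lookup-fromList-All ps i

lookup-fromList-injective : ∀ {A : Set} {xs : List A} → Unique xs → Injective _≡_ _≡_ (lookup (fromList xs))
lookup-fromList-injective (x∉xs ∷ _) {zero}  {zero}  _  = refl
lookup-fromList-injective (x∉xs ∷ _) {zero}  {suc j} eq = ⊥-elim (lookup-fromList-All x∉xs j eq)
lookup-fromList-injective (x∉xs ∷ _) {suc i} {zero}  eq = ⊥-elim (lookup-fromList-All x∉xs i (sym eq))
lookup-fromList-injective (_ ∷ u)    {suc i} {suc j} eq = cong suc (lookup-fromList-injective u eq)

-- From closed walks on arbitrary types to cycles of a `Graph`.

-- A finite simple graph on arbitrary vertex and edge types, together with enumerations of both.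
module Presentation
  {V E : Set} {n k : ℕ} (V↔ : Fin n ↔ V) (E↔ : Fin k ↔ E) (ends : E → V × V)
  (loopless : ∀ e → proj₁ (ends e) ≢ proj₂ (ends e))
  (simple : ∀ e f → ends e ≈ₚ ends f → e ≡ f)
  where

  private
    module V = Inverse V↔
    module E = Inverse E↔

  code : V → Fin n
  code = V.from

  code-injective : Injective _≡_ _≡_ code
  code-injective {u} {w} eq = trans (sym (V.strictlyInverseˡ u)) (trans (cong V.to eq) (V.strictlyInverseˡ w))

  decode-injective : Injective _≡_ _≡_ E.to
  decode-injective {i} {j} eq = trans (sym (E.strictlyInverseʳ i)) (trans (cong E.from eq) (E.strictlyInverseʳ j))

  endsᶠ : Fin k → Fin n × Fin n
  endsᶠ j = orient (Product.map code code (ends (E.to j)))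

  endsᶠ-ends : ∀ j → endsᶠ j ≈ₚ Product.map code code (ends (E.to j))
  endsᶠ-ends j = orient-cases _

  graph : Graph
  graph = record
    { order    = n
    ; size     = k
    ; ends     = endsᶠ
    ; ordered  = λ j → orient-ordered _ (loopless (E.to j) ∘ code-injective)
    ; distinct = λ {i} {j} eq → decode-injective (simple _ _ (≈ₚ-map⁻ code-injective
        (≈ₚ-trans (≈ₚ-sym (endsᶠ-ends i)) (subst (_≈ₚ _) (sym eq) (endsᶠ-ends j)))))
    }

  open Graph graph using (Joins; Adjacent)

  joins⁺ : ∀ {e u w} → ends e ≈ₚ (u , w) → Joins (E.from e) (code u) (code w)
  joins⁺ {e} {u} {w} p = ≈ₚ-trans (endsᶠ-ends (E.from e))
    (subst (λ f → Product.map code code (ends f) ≈ₚ _) (sym (E.strictlyInverseˡ e)) (≈ₚ-map code p))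

  joins⁻ : ∀ {j u w} → Joins j (code u) (code w) → ends (E.to j) ≈ₚ (u , w)
  joins⁻ {j} p = ≈ₚ-map⁻ code-injective (≈ₚ-trans (≈ₚ-sym (endsᶠ-ends j)) p)

  Linked : V → V → Set
  Linked u w = ∃[ e ] ends e ≈ₚ (u , w)

  linked⇒connected : (∀ u w → Star Linked u w) → ∀ i j → Star Adjacent i j
  linked⇒connected path i j = subst₂ (Star Adjacent) (V.strictlyInverseʳ i) (V.strictlyInverseʳ j)
    (gmap code (λ (e , p) → E.from e , joins⁺ p) (path (V.to i) (V.to j)))

  infixr 5 _─_⟨_⟩_

  -- The vertices of a walk are listed without its end point, so that a closed walk lists its start once.
  data Walk : V → List V → List E → V → Set where
    []       : ∀ {u} → Walk u [] [] u
    _─_⟨_⟩_ : ∀ u e {w vs es x} → ends e ≈ₚ (u , w) → Walk w vs es x → Walk u (u ∷ vs) (e ∷ es) x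

  infixr 5 _++ʷ_

  _++ʷ_ : ∀ {u vs es w vs′ es′ x} → Walk u vs es w → Walk w vs′ es′ x → Walk u (vs ++ vs′) (es ++ es′) x
  []            ++ʷ q = q
  (u ─ e ⟨ p ⟩ q) ++ʷ r = u ─ e ⟨ p ⟩ (q ++ʷ r)

  private
    head-vertex : ∀ {u v vs es x} → Walk u (v ∷ vs) es x → v ≡ u
    head-vertex (u ─ _ ⟨ _ ⟩ _) = refl

    step-inner : ∀ {u v vs es x} → Walk u (v ∷ vs) es x → ∀ (i : Fin (length vs)) →
      ∃[ e ] e ∈ es × ends e ≈ₚ (lookup (fromList (v ∷ vs)) (inject₁ i) , lookup (fromList vs) i)
    step-inner (u ─ _ ⟨ p ⟩ q@(_ ─ _ ⟨ _ ⟩ _)) zero = _ , here refl , p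
    step-inner (u ─ _ ⟨ p ⟩ q@(_ ─ _ ⟨ _ ⟩ _)) (suc i) =
      let e , e∈ , r = step-inner q i in e , there e∈ , r

    step-last : ∀ {u v vs es x} → Walk u (v ∷ vs) es x →
      ∃[ e ] e ∈ es × ends e ≈ₚ (lookup (fromList (v ∷ vs)) (maxᶠ (length vs)) , x)
    step-last (u ─ _ ⟨ p ⟩ [])              = _ , here refl , p
    step-last (u ─ _ ⟨ p ⟩ q@(_ ─ _ ⟨ _ ⟩ _)) =
      let e , e∈ , r = step-last q in e , there e∈ , r

    -- At `inject₁ j` the successor is the next list entry. At the last position it wraps round to
    -- the first entry, which is the end of the walk because the walk is closed.
    step : ∀ {u vs es} → Walk u vs es u → ∀ i →
      ∃[ e ] e ∈ es × ends e ≈ₚ (lookup (fromList vs) i , lookup (fromList vs) (next i))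
    step {vs = v ∷ vs} p i with refl ← head-vertex p | view i
    ... | ‵inject₁ j rewrite next-inject₁ j = step-inner p j
    ... | ‵fromℕ rewrite next-max (length vs) = step-last p

    edge-inner : ∀ {u v vs es x e} → Walk u (v ∷ vs) es x → e ∈ es →
      (∃[ i ] ends e ≈ₚ (lookup (fromList (v ∷ vs)) (inject₁ i) , lookup (fromList vs) i))
      ⊎ ends e ≈ₚ (lookup (fromList (v ∷ vs)) (maxᶠ (length vs)) , x)
    edge-inner (u ─ _ ⟨ p ⟩ [])              (here refl) = inj₂ p
    edge-inner (u ─ _ ⟨ p ⟩ q@(_ ─ _ ⟨ _ ⟩ _)) (here refl) = inj₁ (zero , p)
    edge-inner (u ─ _ ⟨ p ⟩ q@(_ ─ _ ⟨ _ ⟩ _)) (there e∈) =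
      Sum.map₁ (λ (i , r) → suc i , r) (edge-inner q e∈)

    edge-step : ∀ {u vs es e} → Walk u vs es u → e ∈ es →
      ∃[ i ] ends e ≈ₚ (lookup (fromList vs) i , lookup (fromList vs) (next i))
    edge-step {vs = []} [] ()
    edge-step {vs = v ∷ vs} {e = e} p e∈ with refl ← head-vertex p | edge-inner p e∈
    ... | inj₁ (j , r) = inject₁ j , subst (λ i → ends e ≈ₚ (at (inject₁ j) , at i)) (sym (next-inject₁ j)) r
      where at = lookup (fromList (v ∷ vs))
    ... | inj₂ r = maxᶠ _ , subst (λ i → ends e ≈ₚ (at (maxᶠ _) , at i)) (sym (next-max (length vs))) r
      where at = lookup (fromList (v ∷ vs))

  _≟ᴱ_ : DecidableEquality E
  e ≟ᴱ f = map′ (λ eq → trans (sym (E.strictlyInverseˡ e)) (trans (cong E.to eq) (E.strictlyInverseˡ f)))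
    (cong E.from) (E.from e ≟ᶠ E.from f)

  open DecMembership _≟ᴱ_ using (_∈?_)

  edgeSet : List E → Subset k
  edgeSet es = tabulateᵛ (λ j → does (E.to j ∈? es))

  ∈-edgeSet : ∀ {es j} → j ∈ˢ edgeSet es ⇔ E.to j ∈ es
  ∈-edgeSet {es} {j} = mk⇔ to from
    where
    to : j ∈ˢ edgeSet es → E.to j ∈ es
    to p with E.to j ∈? es | trans (sym (lookup∘tabulate (λ i → does (E.to i ∈? es)) j)) ([]=⇒lookup p)
    ... | yes e∈ | _ = e∈
    ... | no _   | ()
    from : E.to j ∈ es → j ∈ˢ edgeSet es
    from e∈ = lookup⇒[]= j _ (trans (lookup∘tabulate _ j) (dec-true (E.to j ∈? es) e∈))

  edgeSet-⊆ : ∀ {es fs e} → edgeSet es ≡ edgeSet fs → e ∈ es → e ∈ fs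
  edgeSet-⊆ {es} {fs} {e} eq e∈ = subst (_∈ fs) (E.strictlyInverseˡ e)
    (Equivalence.to ∈-edgeSet (subst (E.from e ∈ˢ_) eq
      (Equivalence.from ∈-edgeSet (subst (_∈ es) (sym (E.strictlyInverseˡ e)) e∈))))

  closed⇒cycle : ∀ {u vs es} → Walk u vs es u → Unique vs → 3 ≤ length vs → IsCycle graph (edgeSet es)
  closed⇒cycle {u} {vs} {es} p unique 3≤ = length vs , mapᵛ code (fromList vs) , 3≤ , injective , adjacent , edges
    where
    v = lookup (fromList vs)
    c = lookup (mapᵛ code (fromList vs))

    c-code : ∀ i → c i ≡ code (v i)
    c-code i = lookup-map i code (fromList vs)

    injective : Injective _≡_ _≡_ c
    injective {i} {j} eq = lookup-fromList-injective unique
      (code-injective (trans (sym (c-code i)) (trans eq (c-code j))))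

    joins-c : ∀ {j i} → Joins j (code (v i)) (code (v (next i))) → Joins j (c i) (c (next i))
    joins-c {j} {i} = subst (λ (p : Fin n × Fin n) → Joins j (proj₁ p) (proj₂ p))
      (sym (cong₂ _,_ (c-code i) (c-code (next i))))

    c-joins : ∀ {j i} → Joins j (c i) (c (next i)) → Joins j (code (v i)) (code (v (next i)))
    c-joins {j} {i} = subst (λ (p : Fin n × Fin n) → Joins j (proj₁ p) (proj₂ p))
      (cong₂ _,_ (c-code i) (c-code (next i)))

    adjacent : ∀ i → Adjacent (c i) (c (next i))
    adjacent i = let e , _ , r = step p i in E.from e , joins-c (joins⁺ r)

    edges : ∀ j → j ∈ˢ edgeSet es ⇔ (∃[ i ] Joins j (c i) (c (next i)))
    edges j = mk⇔
      (λ j∈ → let i , r = edge-step p (Equivalence.to ∈-edgeSet j∈) in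
        i , joins-c (subst (λ f → Joins f (code (v i)) (code (v (next i)))) (E.strictlyInverseʳ j) (joins⁺ r)))
      -- The walk has an edge between the same two vertices, and `simple` identifies the given edge
      -- with it.
      (λ (i , r) → let e , e∈ , r′ = step p i in
        Equivalence.from ∈-edgeSet
          (subst (_∈ es) (simple _ _ (≈ₚ-trans r′ (≈ₚ-sym (joins⁻ (c-joins r))))) e∈))

-- Notation for the corners and edges of the ring.

pattern L g p = g , false , p
pattern R g p = g , true , p

pattern inner g p q = inj₁ (g , p , q)
pattern base p      = inj₂ (inj₁ p)
pattern rung j      = inj₂ (inj₂ (inj₁ j))
pattern link g q    = inj₂ (inj₂ (inj₂ (g , q)))

pattern 0th = here refl
pattern 1st = there (here refl)
pattern 2nd = there (there (here refl))
pattern 3rd = there (there (there (here refl)))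

excess : ∀ o t → ((+ (o + t)) -ℤ + o) +ℤ 1ℤ ≡ + suc t
excess o t = solve 2 (λ o t → ((o :+ t) :- o) :+ con 1ℤ := con 1ℤ :+ t) refl (+ o) (+ t)
  where open ℤ-Solver.+-*-Solver

-- Runs of consecutive gadgets in cyclic order.

-- The end point is not listed, so that chains compose by concatenation and a full round is a chain
-- from a gadget to itself.
data Chain {m} : Fin m → List (Fin m) → Fin m → Set where
  []  : ∀ {g} → Chain g [] g
  _∷_ : ∀ g {gs h} → Chain (next g) gs h → Chain g (g ∷ gs) h

-- Stated for variable end points: where it is applied, matching on the chain directly would have to
-- unify `next g` with `suc i`.
chain-[]⁻ : ∀ {m} {g h : Fin m} → Chain g [] h → g ≡ h
chain-[]⁻ [] = refl

chain-∷⁻ : ∀ {m} {g h i : Fin m} {gs} → Chain g (h ∷ gs) i → g ≡ h × Chain (next h) gs i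
chain-∷⁻ (_ ∷ c) = refl , c

chain-++ : ∀ {m} {g h i : Fin m} {gs hs} → Chain g gs h → Chain h hs i → Chain g (gs ++ hs) i
chain-++ []      d = d
chain-++ (g ∷ c) d = g ∷ chain-++ c d

chain-split : ∀ {m} {g i : Fin m} gs {hs} → Chain g (gs ++ hs) i → ∃[ h ] Chain g gs h × Chain h hs i
chain-split []       c       = _ , [] , c
chain-split (_ ∷ gs) (g ∷ c) = let h , c₁ , c₂ = chain-split gs c in h , g ∷ c₁ , c₂

chain-tabulate : ∀ {m} n (f : Fin (suc n) → Fin m) → (∀ j → f (suc j) ≡ next (f (inject₁ j))) →
  Chain (f zero) (tabulate f) (next (f (maxᶠ n)))
chain-tabulate zero    f eq = f zero ∷ []
chain-tabulate (suc n) f eq =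
  f zero ∷ subst (λ g → Chain g (tabulate (f ∘ suc)) (next (f (maxᶠ (suc n))))) (eq zero)
    (chain-tabulate n (f ∘ suc) (eq ∘ suc))

chain-allFin : ∀ n → Chain zero (allFin (suc n)) zero
chain-allFin n = subst (Chain zero _) (next-max n) (chain-tabulate n id (sym ∘ next-inject₁))

-- Cut the full round `allFin` before `i` and exchange the two pieces. They still form a chain
-- because the round is closed, and a permutation keeps the list complete and free of repetition.
rotation : ∀ {n} (i : Fin (suc n)) →
  ∃[ gs ] Chain (next i) gs i × Unique (i ∷ gs) × (∀ g → g ∈ i ∷ gs)
rotation {n} i with ∈-∃++ (∈-allFin i)
... | xs , ys , eq with chain-split xs (subst (λ gs → Chain zero gs zero) eq (chain-allFin n))
...   | _ , c₁ , (_ ∷ c₂) = ys ++ xs , chain-++ c₂ c₁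
  , Unique-resp-↭ (setoid _) (↭⇒↭ₛ rotated) (Unique.allFin⁺ (suc n))
  , λ g → ∈-resp-↭ rotated (∈-allFin g)
  where
  rotated : allFin (suc n) ↭ i ∷ ys ++ xs
  rotated = subst (_↭ i ∷ ys ++ xs) (sym eq) (++-comm xs (i ∷ ys))

next-≢ : ∀ {k} (g : Fin (suc (suc k))) → next g ≢ g
next-≢ {k} g with view g
... | ‵inject₁ j rewrite next-inject₁ j = λ eq → 1+n≢n (trans (cong toℕ eq) (toℕ-inject₁ j))
... | ‵fromℕ rewrite next-max (suc k) = λ ()

Vec↔ : ∀ {a} {A : Set} n → Fin a ↔ A → Fin (a ^ n) ↔ Vec A n
Vec↔ zero    A↔ = mk↔ₛ′ (λ _ → []) (λ _ → zero) (λ { [] → refl }) (λ { zero → refl })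
Vec↔ (suc n) A↔ = ↔-trans *↔× (↔-trans (A↔ ×-↔ Vec↔ n A↔)
  (mk↔ₛ′ (uncurry _∷_) uncons (λ { (_ ∷ _) → refl }) (λ _ → refl)))

lookup-ext : ∀ {A : Set} {n} {xs ys : Vec A n} → (∀ i → lookup xs i ≡ lookup ys i) → xs ≡ ys
lookup-ext eq = Pointwise-≡⇒≡ (extensional⇒inductive (ext eq))

Fin-irrelevant : ∀ {d} → d ≤ 1 → (i j : Fin d) → i ≡ j
Fin-irrelevant (s≤s z≤n) zero zero = refl

-- The ring as a simple graph.

-- A ring of k + 2 gadgets with corners L g p and R g p. All gadgets but gadget 0
-- are complete bipartite graphs between their L and R corners; gadget 0 is the
-- pair of edges base p together with d + 1 of the two possible rungs.
module Necklace (k d : ℕ) (d≤1 : d ≤ 1) where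

  n = suc k

  Gadget = Fin (suc n)
  Vertex = Gadget × Bool × Bool
  Edge   = (Fin n × Bool × Bool) ⊎ Bool ⊎ Fin (suc d) ⊎ (Gadget × Bool)

  ends : Edge → Vertex × Vertex
  ends (inner g p q)  = L (suc g) p , R (suc g) q
  ends (base p)       = L zero p , R zero p
  ends (rung zero)    = L zero false , L zero true
  ends (rung (suc _)) = R zero false , R zero true
  ends (link g q)     = L (next g) q , R g q

  -- A numbering along which the ends of every edge are listed in ascending order. It excludes
  -- loops, and two edges with the same ends listed in opposite orders.
  corner : Vertex → ℕ
  corner (L _ false) = 0
  corner (L _ true)  = 1
  corner (R _ false) = 2
  corner (R _ true)  = 3

  ascending : ∀ e → corner (proj₁ (ends e)) < corner (proj₂ (ends e))
  ascending (inner _ false false) = s≤s z≤n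
  ascending (inner _ false true)  = s≤s z≤n
  ascending (inner _ true false)  = s≤s (s≤s z≤n)
  ascending (inner _ true true)   = s≤s (s≤s z≤n)
  ascending (base false)          = s≤s z≤n
  ascending (base true)           = s≤s (s≤s z≤n)
  ascending (rung zero)           = s≤s z≤n
  ascending (rung (suc _))        = s≤s (s≤s (s≤s z≤n))
  ascending (link _ false)        = s≤s z≤n
  ascending (link _ true)         = s≤s (s≤s z≤n)

  loopless : ∀ e → proj₁ (ends e) ≢ proj₂ (ends e)
  loopless e eq = <-irrefl (cong corner eq) (ascending e)

  -- The ends of a link lie in different gadgets; this tells links from inner and base edges, which
  -- also run from an L to an R corner.
  link-gadgets : ∀ {h g : Gadget} {s t : Bool × Bool} {q : Bool} → ((h , s) , (h , t)) ≢ (L (next g) q , R g q)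
  link-gadgets {g = g} eq = next-≢ g
    (trans (sym (cong (proj₁ ∘ proj₁) eq)) (cong (proj₁ ∘ proj₂) eq))

  ends-injective : ∀ e f → ends e ≡ ends f → e ≡ f
  ends-injective (inner g p q) (inner _ _ _) refl = refl
  ends-injective (inner g p q) (base _) ()
  ends-injective (inner g p q) (rung zero) ()
  ends-injective (inner g p q) (rung (suc _)) ()
  ends-injective (inner g p q) (link h _) eq = ⊥-elim (link-gadgets eq)
  ends-injective (base p) (inner _ _ _) ()
  ends-injective (base p) (base _) refl = refl
  ends-injective (base p) (rung zero) ()
  ends-injective (base p) (rung (suc _)) ()
  ends-injective (base p) (link h _) eq = ⊥-elim (link-gadgets eq)
  ends-injective (rung zero) (inner _ _ _) ()
  ends-injective (rung zero) (base _) ()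
  ends-injective (rung zero) (rung zero) eq = refl
  ends-injective (rung zero) (rung (suc _)) ()
  ends-injective (rung zero) (link _ _) ()
  ends-injective (rung (suc _)) (inner _ _ _) ()
  ends-injective (rung (suc _)) (base _) ()
  ends-injective (rung (suc _)) (rung zero) ()
  ends-injective (rung (suc i)) (rung (suc j)) eq = cong (λ i → rung (suc i)) (Fin-irrelevant d≤1 i j)
  ends-injective (rung (suc _)) (link _ _) ()
  ends-injective (link h _) (inner _ _ _) eq = ⊥-elim (link-gadgets (sym eq))
  ends-injective (link h _) (base _) eq = ⊥-elim (link-gadgets (sym eq))
  ends-injective (link _ _) (rung zero) ()
  ends-injective (link _ _) (rung (suc _)) ()
  ends-injective (link g p) (link h q) eq =
    cong₂ (λ g q → link g q) (cong (proj₁ ∘ proj₂) eq) (cong (proj₂ ∘ proj₂ ∘ proj₂) eq)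

  simple : ∀ e f → ends e ≈ₚ ends f → e ≡ f
  simple e f (inj₁ eq) = ends-injective e f eq
  simple e f (inj₂ eq) = ⊥-elim (<-asym (ascending f)
    (subst (λ p → corner (proj₁ p) < corner (proj₂ p)) eq (ascending e)))

  Vertex↔ : Fin (suc n * (2 * 2)) ↔ Vertex
  Vertex↔ = ↔-trans *↔× (↔-refl ×-↔ ↔-trans *↔× (2↔Bool ×-↔ 2↔Bool))

  Edge↔ : Fin (n * (2 * 2) + (2 + (suc d + suc n * 2))) ↔ Edge
  Edge↔ = ↔-trans +↔⊎ (↔-trans *↔× (↔-refl ×-↔ ↔-trans *↔× (2↔Bool ×-↔ 2↔Bool)) ⊎-↔
    ↔-trans +↔⊎ (2↔Bool ⊎-↔ ↔-trans +↔⊎ (↔-refl ⊎-↔ ↔-trans *↔× (↔-refl ×-↔ 2↔Bool))))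

  open Presentation Vertex↔ Edge↔ ends loopless simple public

  -- Pieces of cycles and their concatenation.

  owner : Edge → Gadget
  owner (inner g _ _) = suc g
  owner (base _)      = zero
  owner (rung _)      = zero
  owner (link g _)    = g

  -- A part of a cycle running through the gadgets gs. It avoids the edges that
  -- are not Allowed and contains those owned by gs that are Forced; a cycle is
  -- reconstructed from its edge set by means of these two properties.
  record Thread (Allowed Forced : Edge → Set) (gs : List Gadget) (u w : Vertex) : Set where
    field
      {vertices} : List Vertex
      {edges}    : List Edge
      walk       : Walk u vertices edges w
      unique     : Unique vertices
      long       : 2 * length gs ≤ length vertices
      within     : All (λ v → proj₁ v ∈ gs) vertices
      allowed    : All Allowed edges
      forced     : ∀ {e} → owner e ∈ gs → Forced e → e ∈ edges

  open Thread

  Loop : (Allowed Forced : Edge → Set) → Set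
  Loop Allowed Forced = ∃[ gs ] ∃[ u ] Thread Allowed Forced gs u u × 2 ≤ length gs × (∀ g → g ∈ gs)

  -- By `within`, the vertices of the two threads lie in different gadgets, so none is repeated.
  _∷ᵗ_ : ∀ {Allowed Forced g gs u w x} → Thread Allowed Forced [ g ] u w → Thread Allowed Forced gs w x →
    {{g ∉ gs}} → Thread Allowed Forced (g ∷ gs) u x
  _∷ᵗ_ {Forced = Forced} {g} {gs} s t {{g∉gs}} = record
    { walk    = walk s ++ʷ walk t
    ; unique  = Unique.++⁺ (unique s) (unique t) λ (v∈s , v∈t) →
        g∉gs (subst (_∈ gs) (within-[] (lookupᴬ (within s) v∈s)) (lookupᴬ (within t) v∈t))
    ; long    = subst₂ _≤_ (sym (*-distribˡ-+ 2 1 (length gs))) (sym (length-++ (vertices s)))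
        (+-mono-≤ (long s) (long t))
    ; within  = ++⁺ (mapᴬ (λ { (here eq) → here eq }) (within s)) (mapᴬ there (within t))
    ; allowed = ++⁺ (allowed s) (allowed t)
    ; forced  = λ
        { (here eq)  f → ∈-++⁺ˡ (forced s (here eq) f)
        ; (there e∈) f → ∈-++⁺ʳ (edges s) (forced t e∈ f)
        }
    }
    where
    within-[] : ∀ {h} → h ∈ [ g ] → h ≡ g
    within-[] (here eq) = eq

  []ᵗ : ∀ {Allowed Forced u} → Thread Allowed Forced [] u u
  []ᵗ = record { walk = [] ; unique = [] ; long = z≤n ; within = [] ; allowed = [] ; forced = λ () }

  L-distinct : ∀ {g : Gadget} p → _≢_ {A = Vertex} (L g p) (L g (not p))
  L-distinct p eq = not-¬ refl (cong (proj₂ ∘ proj₂) eq)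

  R-distinct : ∀ {g : Gadget} p → _≢_ {A = Vertex} (R g p) (R g (not p))
  R-distinct p eq = not-¬ refl (cong (proj₂ ∘ proj₂) eq)

  not-L-distinct : ∀ {g : Gadget} p → _≢_ {A = Vertex} (L g (not p)) (L g p)
  not-L-distinct p = L-distinct p ∘ sym

  not-R-distinct : ∀ {g : Gadget} p → _≢_ {A = Vertex} (R g (not p)) (R g p)
  not-R-distinct p = R-distinct p ∘ sym

  fresh : ∀ {g : Gadget} {gs} {s : Bool × Bool} {vs : List Vertex} →
    g ∉ gs → All (λ v → proj₁ v ∈ gs) vs → All ((g , s) ≢_) vs
  fresh g∉gs = mapᴬ λ { v∈ refl → g∉gs v∈ }

  left-rung : ∀ p → ends (rung zero) ≈ₚ (L zero p , L zero (not p))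
  left-rung false = inj₁ refl
  left-rung true  = inj₂ refl

  right-rung : ∀ {j} p → ends (rung (suc j)) ≈ₚ (R zero p , R zero (not p))
  right-rung false = inj₁ refl
  right-rung true  = inj₂ refl

  -- Cycles winding once round the ring.

  module Winding (q₀ : Bool) (r₀ : Fin (suc d)) (choices : Vec (Bool × Bool) n) where

    exit : Gadget → Bool
    exit zero    = q₀
    exit (suc g) = proj₁ (lookup choices g)

    detour : Fin n → Bool
    detour g = proj₂ (lookup choices g)

    -- The link leaving a gadget reveals its exit, and the right rung reveals `r₀`. Of the inner
    -- edges at the R corner other than the exit, a detour uses both and a direct crossing none.
    Allowed : Edge → Set
    Allowed (inner g _ q)  = detour g ≡ false → q ≡ exit (suc g)
    Allowed (base _)       = ⊤
    Allowed (rung zero)    = ⊤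
    Allowed (rung (suc j)) = suc j ≡ r₀
    Allowed (link g q)     = q ≡ exit g

    Forced : Edge → Set
    Forced (inner g p q)  = detour g ≡ true × q ≡ not (exit (suc g))
    Forced (base _)       = ⊥
    Forced (rung zero)    = ⊥
    Forced (rung (suc j)) = suc j ≡ r₀
    Forced (link g q)     = q ≡ exit g

    -- The right rung is used exactly if `r` is a successor; the left rung is then added if it is
    -- needed to come out at `q₀`. The equation `r ≡ r₀` allows matching on `r` while `Allowed` and
    -- `Forced` still speak of `r₀`.
    pass-base : ∀ p r → r ≡ r₀ → Thread Allowed Forced [ zero ] (L zero p) (L (next zero) q₀)
    pass-base p r eq with p ≟ᵇ q₀
    pass-base p zero eq | yes refl = record
      { walk    = L zero p ─ base p ⟨ inj₁ refl ⟩ R zero p ─ link zero p ⟨ inj₂ refl ⟩ []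
      ; unique  = ((λ ()) ∷ []) ∷ [] ∷ []
      ; long    = ≤-refl
      ; within  = 0th ∷ 0th ∷ []
      ; allowed = tt ∷ refl ∷ []
      ; forced  = λ
          { {inner _ _ _} (here ())
          ; {rung (suc j)} _ f → ⊥-elim (0≢1+n (trans eq (sym f)))
          ; {link _ _} 0th refl → 1st
          }
      }
    pass-base p zero eq | no p≢q rewrite ¬-not p≢q = record
      { walk    = L zero (not q₀) ─ rung zero ⟨ ≈ₚ-trans (left-rung q₀) (inj₂ refl) ⟩
          L zero q₀ ─ base q₀ ⟨ inj₁ refl ⟩ R zero q₀ ─ link zero q₀ ⟨ inj₂ refl ⟩ []
      ; unique  = (not-L-distinct q₀ ∷ (λ ()) ∷ []) ∷ ((λ ()) ∷ []) ∷ [] ∷ []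
      ; long    = m≤n+m 2 1
      ; within  = 0th ∷ 0th ∷ 0th ∷ []
      ; allowed = tt ∷ tt ∷ refl ∷ []
      ; forced  = λ
          { {inner _ _ _} (here ())
          ; {rung (suc j)} _ f → ⊥-elim (0≢1+n (trans eq (sym f)))
          ; {link _ _} 0th refl → 2nd
          }
      }
    pass-base p (suc r) eq | yes refl = record
      { walk    = L zero p ─ rung zero ⟨ left-rung p ⟩ L zero (not p) ─ base (not p) ⟨ inj₁ refl ⟩
          R zero (not p) ─ rung (suc r) ⟨ ≈ₚ-trans (right-rung {r} p) (inj₂ refl) ⟩
          R zero p ─ link zero p ⟨ inj₂ refl ⟩ []
      ; unique  = (L-distinct p ∷ (λ ()) ∷ (λ ()) ∷ []) ∷ ((λ ()) ∷ (λ ()) ∷ [])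
          ∷ (not-R-distinct p ∷ []) ∷ [] ∷ []
      ; long    = m≤n+m 2 2
      ; within  = 0th ∷ 0th ∷ 0th ∷ 0th ∷ []
      ; allowed = tt ∷ tt ∷ eq ∷ refl ∷ []
      ; forced  = λ
          { {inner _ _ _} (here ())
          ; {rung (suc j)} _ f → there (there (here (cong (λ i → rung i) (trans f (sym eq)))))
          ; {link _ _} 0th refl → 3rd
          }
      }
    pass-base p (suc r) eq | no p≢q rewrite ¬-not p≢q = record
      { walk    = L zero (not q₀) ─ base (not q₀) ⟨ inj₁ refl ⟩
          R zero (not q₀) ─ rung (suc r) ⟨ ≈ₚ-trans (right-rung {r} q₀) (inj₂ refl) ⟩
          R zero q₀ ─ link zero q₀ ⟨ inj₂ refl ⟩ []
      ; unique  = ((λ ()) ∷ (λ ()) ∷ []) ∷ (not-R-distinct q₀ ∷ []) ∷ [] ∷ []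
      ; long    = m≤n+m 2 1
      ; within  = 0th ∷ 0th ∷ 0th ∷ []
      ; allowed = tt ∷ eq ∷ refl ∷ []
      ; forced  = λ
          { {inner _ _ _} (here ())
          ; {rung (suc j)} _ f → there (here (cong (λ i → rung i) (trans f (sym eq))))
          ; {link _ _} 0th refl → 2nd
          }
      }

    -- The gadget is a 4-cycle in which the entry and the exit are adjacent: one path between them
    -- is the edge, the other visits all four corners.
    pass-suc : ∀ g p → Thread Allowed Forced [ suc g ] (L (suc g) p) (L (next (suc g)) (exit (suc g)))
    pass-suc g p with exit (suc g) in q-eq | detour g in y-eq
    ... | q | false = record
      { walk    = L (suc g) p ─ inner g p q ⟨ inj₁ refl ⟩ R (suc g) q ─ link (suc g) q ⟨ inj₂ refl ⟩ []
      ; unique  = ((λ ()) ∷ []) ∷ [] ∷ []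
      ; long    = ≤-refl
      ; within  = 0th ∷ 0th ∷ []
      ; allowed = (λ _ → sym q-eq) ∷ sym q-eq ∷ []
      ; forced  = λ
          { {inner _ _ _} 0th (y , _) → ⊥-elim (not-¬ y-eq y)
          ; {link _ _} 0th f → there (here (cong (link (suc g)) (trans f q-eq)))
          }
      }
    ... | q | true = record
      { walk    = L (suc g) p ─ inner g p (not q) ⟨ inj₁ refl ⟩
          R (suc g) (not q) ─ inner g (not p) (not q) ⟨ inj₂ refl ⟩
          L (suc g) (not p) ─ inner g (not p) q ⟨ inj₁ refl ⟩ R (suc g) q ─ link (suc g) q ⟨ inj₂ refl ⟩ []
      ; unique  = ((λ ()) ∷ L-distinct p ∷ (λ ()) ∷ [])
          ∷ ((λ ()) ∷ not-R-distinct q ∷ []) ∷ ((λ ()) ∷ []) ∷ [] ∷ []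
      ; long    = m≤n+m 2 2
      ; within  = 0th ∷ 0th ∷ 0th ∷ 0th ∷ []
      ; allowed = detours ∷ detours ∷ detours ∷ sym q-eq ∷ []
      ; forced  = λ
          { {inner _ p′ _} 0th (_ , refl) → used p′
          ; {link _ _} 0th f → there (there (there (here (cong (link (suc g)) (trans f q-eq)))))
          }
      }
      where
      detours : ∀ {q} → detour g ≡ false → q ≡ exit (suc g)
      detours y = ⊥-elim (not-¬ y-eq y)

      used : ∀ p′ → inner g p′ (not (exit (suc g))) ∈
        inner g p (not q) ∷ inner g (not p) (not q) ∷ inner g (not p) q ∷ link (suc g) q ∷ []
      used p′ with p′ ≟ᵇ p
      ... | yes refl = here (cong (λ q → inner g p (not q)) q-eq)
      ... | no p′≢p  = there (here (cong₂ (λ p q → inner g p (not q)) (¬-not p′≢p) q-eq))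

    final : Bool → List Gadget → Bool
    final p []       = p
    final p (g ∷ gs) = final (exit g) gs

    pass : ∀ g p → Thread Allowed Forced [ g ] (L g p) (L (next g) (exit g))
    pass zero    p = pass-base p r₀ refl
    pass (suc g) p = pass-suc g p

    passes : ∀ {g gs h} → Chain g gs h → Unique gs → ∀ p → Thread Allowed Forced gs (L g p) (L h (final p gs))
    passes []      _              p = []ᵗ
    passes (g ∷ c) (g∉gs ∷ u) p = (pass g p ∷ᵗ passes c u (exit g)) {{All¬⇒¬Any g∉gs}}

    loop : Loop Allowed Forced
    -- The start must be the corner reached after a full round. On a nonempty list `final` does not
    -- depend on its first argument, so start and end agree by computation.
    loop = allFin (suc n) , _ , passes (chain-allFin n) (Unique.allFin⁺ (suc n)) (final q₀ (allFin (suc n)))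
      , s≤s (s≤s z≤n) , ∈-allFin

  -- Cycles running twice round the ring.

  -- The cycle runs twice round the ring, from the R corners of gadget suc i back
  -- to its L corners, and turns round at both ends of this tour.
  module Doubling (i : Fin n) (bits : Vec Bool n) where

    bit : Fin n → Bool
    bit = lookup bits

    -- The missing links into `suc i` reveal the gap. The inner edge between the two `false` corners
    -- reveals the bit: whether a gadget is crossed or closes an end, this edge is used exactly when
    -- the bit is `false`.
    Allowed : Edge → Set
    Allowed (inner g p q) = p ≡ false → q ≡ false → bit g ≡ false
    Allowed (base _)      = ⊤
    Allowed (rung _)      = ⊤
    Allowed (link g _)    = next g ≢ suc i

    Forced : Edge → Set
    Forced (inner g p q) = p ≡ false × q ≡ false × bit g ≡ false
    Forced (base _)      = ⊥
    Forced (rung _)      = ⊥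
    Forced (link g _)    = next g ≢ suc i

    link-∈ : ∀ {g : Gadget} q q′ → _∈_ {A = Edge} (link g q′) (link g q ∷ link g (not q) ∷ [])
    link-∈ {g} q q′ with q′ ≟ᵇ q
    ... | yes refl = 0th
    ... | no q′≢q  = there (here (cong (λ q → link g q) (¬-not q′≢q)))

    -- Both strands as one thread: it enters at `L g p`, turns at the far end, and comes back to
    -- `L g (not p)`, which it leaves by `e`. In the recursion `e` is a link owned by the preceding
    -- gadget, so `forced` does not cover it and its membership is recorded separately.
    DoubleThread : Gadget → Bool → List Gadget → Vertex → Edge → Set
    DoubleThread g p gs w e = ∃[ t ] e ∈ edges {Allowed} {Forced} {gs} {L g p} {w} t

    -- The thread `t` through the remaining gadgets is nested between the outgoing edge `f₁` and the
    -- returning edge `f₂`; these stand for the two base edges or for two disjoint inner edges.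
    straddle : ∀ {g p q gs w e} f₁ f₂ → ends f₁ ≈ₚ (L g p , R g q) → ends f₂ ≈ₚ (L g (not p) , R g (not q)) →
      Allowed f₁ → Allowed f₂ → next g ≢ suc i → g ∉ gs →
      (∀ {f} → owner f ≡ g → Forced f → f ∈ f₁ ∷ f₂ ∷ link g q ∷ link g (not q) ∷ []) →
      ends e ≈ₚ (L g (not p) , w) → Allowed e →
      DoubleThread (next g) q gs (R g (not q)) (link g (not q)) → DoubleThread g p (g ∷ gs) w e
    straddle {g} {p} {q} {gs} {w} {e} f₁ f₂ f₁-ends f₂-ends f₁-allowed f₂-allowed g-inner g∉gs f-used
      e-ends e-allowed (t , link-used) =
      record
      { walk    = L g p ─ f₁ ⟨ f₁-ends ⟩ R g q ─ link g q ⟨ inj₂ refl ⟩ walk t ++ʷ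
          R g (not q) ─ f₂ ⟨ ≈ₚ-trans f₂-ends (inj₂ refl) ⟩ L g (not p) ─ e ⟨ e-ends ⟩ []
      ; unique  = ((λ ()) ∷ ++⁺ (fresh g∉gs (within t)) ((λ ()) ∷ L-distinct p ∷ []))
          ∷ ++⁺ (fresh g∉gs (within t)) (R-distinct q ∷ (λ ()) ∷ [])
          ∷ Unique.++⁺ (unique t) (((λ ()) ∷ []) ∷ [] ∷ []) λ
              { (v∈ , 0th) → g∉gs (lookupᴬ (within t) v∈)
              ; (v∈ , 1st) → g∉gs (lookupᴬ (within t) v∈)
              }
      ; long    = subst₂ _≤_ (sym (*-distribˡ-+ 2 1 (length gs)))
          (cong (λ l → suc (suc l)) (sym (length-++ (vertices t))))
          (+-monoʳ-≤ 2 (≤-trans (long t) (m≤m+n _ 2)))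
      ; within  = 0th ∷ 0th ∷ ++⁺ (mapᴬ there (within t)) (0th ∷ 0th ∷ [])
      ; allowed = f₁-allowed ∷ g-inner ∷ ++⁺ (allowed t) (f₂-allowed ∷ e-allowed ∷ [])
      ; forced  = λ
          { (here eq)  f → place (f-used eq f)
          ; (there e∈) f → there (there (∈-++⁺ˡ (forced t e∈ f)))
          }
      } , there (there (∈-++⁺ʳ (edges t) 1st))
      where
      place : ∀ {f} → f ∈ f₁ ∷ f₂ ∷ link g q ∷ link g (not q) ∷ [] → f ∈ f₁ ∷ link g q ∷ edges t ++ f₂ ∷ e ∷ []
      place 0th = 0th
      place 1st = there (there (∈-++⁺ʳ (edges t) 0th))
      place 2nd = 1st
      place 3rd = there (there (∈-++⁺ˡ link-used))

    -- The turn in the gadget before the gap: gadget 0 turns on its left rung, any other at the R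
    -- corner chosen by its bit.
    cap : ∀ g p {w e} → next g ≡ suc i → ends e ≈ₚ (L g (not p) , w) → Allowed e → DoubleThread g p [ g ] w e
    cap zero p {e = e} last e-ends e-allowed = record
      { walk    = L zero p ─ rung zero ⟨ left-rung p ⟩ L zero (not p) ─ e ⟨ e-ends ⟩ []
      ; unique  = (L-distinct p ∷ []) ∷ [] ∷ []
      ; long    = ≤-refl
      ; within  = 0th ∷ 0th ∷ []
      ; allowed = tt ∷ e-allowed ∷ []
      ; forced  = λ
          { {inner _ _ _} (here ())
          ; {link _ _} 0th f → ⊥-elim (f last)
          }
      } , 1st
    cap (suc g) p {e = e} last e-ends e-allowed = record
      { walk    = L (suc g) p ─ inner g p (bit g) ⟨ inj₁ refl ⟩
          R (suc g) (bit g) ─ inner g (not p) (bit g) ⟨ inj₂ refl ⟩ L (suc g) (not p) ─ e ⟨ e-ends ⟩ []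
      ; unique  = ((λ ()) ∷ L-distinct p ∷ []) ∷ ((λ ()) ∷ []) ∷ [] ∷ []
      ; long    = m≤n+m 2 1
      ; within  = 0th ∷ 0th ∷ 0th ∷ []
      ; allowed = (λ _ b → b) ∷ (λ _ b → b) ∷ e-allowed ∷ []
      ; forced  = λ
          { {inner _ _ _} 0th (refl , refl , b) → used p b
          ; {link _ _} 0th f → ⊥-elim (f last)
          }
      } , 2nd
      where
      used : ∀ p → bit g ≡ false → inner g false false ∈ inner g p (bit g) ∷ inner g (not p) (bit g) ∷ e ∷ []
      used false b = here (cong (inner g false) (sym b))
      used true  b = there (here (cong (inner g false) (sym b)))

    straddle-gadget : ∀ g p {gs w e} → next g ≢ suc i → g ∉ gs → ends e ≈ₚ (L g (not p) , w) → Allowed e →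
      (∀ q → DoubleThread (next g) q gs (R g (not q)) (link g (not q))) → DoubleThread g p (g ∷ gs) w e
    straddle-gadget zero p g-inner g∉gs e-ends e-allowed t =
      straddle (base p) (base (not p)) (inj₁ refl) (inj₁ refl) tt tt g-inner g∉gs
        (λ { {inner _ _ _} () ; {link _ q} refl _ → there (there (link-∈ p q)) })
        e-ends e-allowed (t p)
    straddle-gadget (suc g) p g-inner g∉gs e-ends e-allowed t =
      straddle (inner g p q) (inner g (not p) (not q)) (inj₁ refl) (inj₁ refl) (allow p) (allow-not p) g-inner g∉gs
        (λ { {inner _ _ _} refl (refl , refl , b) → used p b ; {link _ q′} refl _ → there (there (link-∈ q q′)) })
        e-ends e-allowed (t q)
      where
      -- The pair of inner edges is straight for bit `false` and crossed for bit `true`, whichever L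
      -- corner is entered first.
      q = p xor bit g

      allow : ∀ p → p ≡ false → p xor bit g ≡ false → bit g ≡ false
      allow false _ b = b

      allow-not : ∀ p → not p ≡ false → not (p xor bit g) ≡ false → bit g ≡ false
      allow-not true _ b = trans (sym (not-involutive (bit g))) b

      used : ∀ p {es} → bit g ≡ false →
        inner g false false ∈ inner g p (p xor bit g) ∷ inner g (not p) (not (p xor bit g)) ∷ es
      used false b = here (cong (inner g false) (sym b))
      used true  b = there (here (cong (inner g false) (trans (sym b) (sym (not-involutive (bit g))))))

    -- Every gadget but the last of the chain is straddled. Since `suc i` occurs only as the end
    -- point, no link before the last gadget enters it.
    doubles : ∀ g gs → Chain (next g) gs (suc i) → Unique (g ∷ gs) → suc i ∉ g ∷ gs → ∀ p {w e} →
      ends e ≈ₚ (L g (not p) , w) → Allowed e → DoubleThread g p (g ∷ gs) w e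
    doubles g []       c _ _ p = cap g p (chain-[]⁻ c)
    doubles g (h ∷ gs) c (g∉gs ∷ u) i∉gs p e-ends e-allowed with refl , c′ ← chain-∷⁻ c =
      straddle-gadget g p g-inner (All¬⇒¬Any g∉gs) e-ends e-allowed
        λ q → doubles h gs c′ u (i∉gs ∘ there) q (inj₁ refl) g-inner
      where
      g-inner : next g ≢ suc i
      g-inner eq = i∉gs (there (here (sym eq)))

    -- The turn on the other side of the gap: the two R corners of `suc i` are joined through the L
    -- corner chosen by its bit.
    close : ∀ {gs} → suc i ∉ gs → DoubleThread (next (suc i)) false gs (R (suc i) true) (link (suc i) true) →
      Thread Allowed Forced (suc i ∷ gs) (R (suc i) false) (R (suc i) false)
    close {gs} i∉gs (t , link-used) = record
      { walk    = R (suc i) false ─ link (suc i) false ⟨ inj₂ refl ⟩ walk t ++ʷ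
          R (suc i) true ─ inner i (bit i) true ⟨ inj₂ refl ⟩
          L (suc i) (bit i) ─ inner i (bit i) false ⟨ inj₁ refl ⟩ []
      ; unique  = ++⁺ (fresh i∉gs (within t)) ((λ ()) ∷ (λ ()) ∷ [])
          ∷ Unique.++⁺ (unique t) (((λ ()) ∷ []) ∷ [] ∷ []) λ
              { (v∈ , 0th) → i∉gs (lookupᴬ (within t) v∈)
              ; (v∈ , 1st) → i∉gs (lookupᴬ (within t) v∈)
              }
      ; long    = subst₂ _≤_ (sym (*-distribˡ-+ 2 1 (length gs)))
          (cong suc (trans (sym (+-suc _ 1)) (sym (length-++ (vertices t)))))
          (+-monoʳ-≤ 2 (≤-trans (long t) (m≤m+n _ 1)))
      ; within  = 0th ∷ ++⁺ (mapᴬ there (within t)) (0th ∷ 0th ∷ [])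
      ; allowed = next-≢ (suc i) ∷ ++⁺ (allowed t) ((λ _ ()) ∷ (λ b _ → b) ∷ [])
      ; forced  = λ
          { {inner _ _ _} 0th (refl , refl , b) →
              there (∈-++⁺ʳ (edges t) (there (here (cong (λ p → inner i p false) (sym b)))))
          ; {link _ q} 0th _ → link-used′ q
          ; (there e∈) f → there (∈-++⁺ˡ (forced t e∈ f))
          }
      }
      where
      link-used′ : ∀ q → link (suc i) q ∈
        link (suc i) false ∷ edges t ++ inner i (bit i) true ∷ inner i (bit i) false ∷ []
      link-used′ false = 0th
      link-used′ true  = there (∈-++⁺ˡ link-used)

    loop : Loop Allowed Forced
    loop with rotation (suc i)
    ... | []     , c , _ , _ = ⊥-elim (next-≢ (suc i) (chain-[]⁻ c))
    ... | h ∷ gs , c , i∉gs ∷ u , all∈ with refl , c′ ← chain-∷⁻ c =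
      suc i ∷ h ∷ gs , R (suc i) false
      , close (All¬⇒¬Any i∉gs)
          (doubles h gs c′ u (All¬⇒¬Any i∉gs) false (inj₁ refl) (next-≢ (suc i)))
      , s≤s (s≤s z≤n) , all∈

  -- Distinct choices give distinct cycles.

  Choice : Set
  Choice = (Bool × Fin (suc d) × Vec (Bool × Bool) n) ⊎ (Fin n × Vec Bool n)

  Allowed Forced : Choice → Edge → Set
  Allowed (inj₁ (q , r , v)) = Winding.Allowed q r v
  Allowed (inj₂ (i , b))     = Doubling.Allowed i b
  Forced (inj₁ (q , r , v))  = Winding.Forced q r v
  Forced (inj₂ (i , b))      = Doubling.Forced i b

  loop : ∀ x → Loop (Allowed x) (Forced x)
  loop (inj₁ (q , r , v)) = Winding.loop q r v
  loop (inj₂ (i , b))     = Doubling.loop i b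

  cycle : Choice → Subset (size graph)
  cycle x = let _ , _ , t , _ = loop x in edgeSet (edges t)

  cycle-isCycle : ∀ x → IsCycle graph (cycle x)
  cycle-isCycle x = let _ , _ , t , 2≤ , _ = loop x in
    -- Two gadgets with two vertices each give four vertices, more than the three required.
    closed⇒cycle (walk t) (unique t) (≤-trans (n≤1+n 3) (≤-trans (*-monoʳ-≤ 2 2≤) (long t)))

  -- The loop of `x` meets the owner of every edge, so it contains each forced edge; equal edge sets
  -- place that edge in the loop of `y`, which has only allowed edges.
  forced⇒allowed : ∀ x y → cycle x ≡ cycle y → ∀ {e} → Forced x e → Allowed y e
  forced⇒allowed x y eq {e} f = let _ , _ , s , _ , all∈ = loop x ; _ , _ , t , _ = loop y in
    lookupᴬ (allowed t) (edgeSet-⊆ {edges s} {edges t} eq (forced s (all∈ (owner e)) f))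

  winding-injective : ∀ {q r v q′ r′ v′} → let x = inj₁ (q , r , v) ; y = inj₁ (q′ , r′ , v′) in
    (∀ {e} → Forced x e → Allowed y e) → (∀ {e} → Forced y e → Allowed x e) → x ≡ y
  winding-injective {q} {r} {v} {q′} {r′} {v′} to from =
    cong₂ (λ q w → inj₁ (q , w)) (exits zero) (cong₂ _,_ (rungs r r′ to-rung from-rung)
      (lookup-ext λ g → cong₂ _,_ (exits (suc g)) (detours g)))
    where
    module X = Winding q r v
    module Y = Winding q′ r′ v′

    exits : ∀ g → X.exit g ≡ Y.exit g
    exits g = to {link g (X.exit g)} refl

    to-rung : ∀ j → suc j ≡ r → suc j ≡ r′
    to-rung j = to {rung (suc j)}

    from-rung : ∀ j → suc j ≡ r′ → suc j ≡ r
    from-rung j = from {rung (suc j)}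

    rungs : ∀ r r′ → (∀ j → suc j ≡ r → suc j ≡ r′) → (∀ j → suc j ≡ r′ → suc j ≡ r) → r ≡ r′
    rungs (suc j) r′      f _ = f j refl
    rungs zero    zero    _ _ = refl
    rungs zero    (suc j) _ f = sym (f j refl)

    detours : ∀ g → X.detour g ≡ Y.detour g
    detours g with X.detour g in x-eq | Y.detour g in y-eq
    ... | true  | true  = refl
    ... | false | false = refl
    -- A detour forces an inner edge at the corner opposite to the exit, while a direct crossing
    -- allows only the exit corner; but the exits agree.
    ... | true  | false = ⊥-elim (not-¬ (exits (suc g))
      (sym (trans (cong not (sym (to {inner g false _} (x-eq , refl) y-eq))) (not-involutive _))))
    ... | false | true  = ⊥-elim (not-¬ (sym (exits (suc g)))
      (sym (trans (cong not (sym (from {inner g false _} (y-eq , refl) x-eq))) (not-involutive _))))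

  -- A doubled cycle uses both links leaving `suc i`, a winding cycle only the one at its exit.
  winding-≢-doubling : ∀ {q r v i b} → let x = inj₁ (q , r , v) ; y = inj₂ (i , b) in
    (∀ {e} → Forced y e → Allowed x e) → ⊥
  winding-≢-doubling {i = i} from
    with () ← trans (from {link (suc i) false} (next-≢ (suc i))) (sym (from {link (suc i) true} (next-≢ (suc i))))

  doubling-injective : ∀ {i b i′ b′} → let x = inj₂ (i , b) ; y = inj₂ (i′ , b′) in
    (∀ {e} → Forced x e → Allowed y e) → (∀ {e} → Forced y e → Allowed x e) → x ≡ y
  doubling-injective {i} {b} {i′} {b′} to from =
    cong₂ (λ i b → inj₂ (i , b)) gaps (lookup-ext bits)
    where
    gaps : i ≡ i′
    gaps with i ≟ᶠ i′
    ... | yes eq = eq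
    -- The links from `inject₁ i′` enter `suc i′`: they are omitted for the gap `i′` but forced for
    -- any other gap.
    ... | no i≢i′ = ⊥-elim (to {link (inject₁ i′) true}
      (λ eq → i≢i′ (sym (suc-injective (trans (sym (next-inject₁ i′)) eq)))) (next-inject₁ i′))

    bits : ∀ g → lookup b g ≡ lookup b′ g
    bits g with lookup b g in x-eq | lookup b′ g in y-eq
    ... | true  | true  = refl
    ... | false | false = refl
    ... | true  | false with () ← trans (sym x-eq) (from {inner g false false} (refl , refl , y-eq) refl refl)
    ... | false | true  with () ← trans (sym y-eq) (to {inner g false false} (refl , refl , x-eq) refl refl)

  cycle-injective : Injective _≡_ _≡_ cycle
  cycle-injective {x} {y} eq = cases x y (forced⇒allowed x y eq) (forced⇒allowed y x (sym eq))
    where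
    cases : ∀ x y → (∀ {e} → Forced x e → Allowed y e) → (∀ {e} → Forced y e → Allowed x e) → x ≡ y
    cases (inj₁ _) (inj₁ _) to from = winding-injective (λ {e} → to {e}) (λ {e} → from {e})
    cases (inj₁ (q , r , v)) (inj₂ (i , b)) to from =
      ⊥-elim (winding-≢-doubling {q} {r} {v} {i} {b} (λ {e} → from {e}))
    cases (inj₂ (i , b)) (inj₁ (q , r , v)) to from =
      ⊥-elim (winding-≢-doubling {q} {r} {v} {i} {b} (λ {e} → to {e}))
    cases (inj₂ _) (inj₂ _) to from = doubling-injective (λ {e} → to {e}) (λ {e} → from {e})

  Choice↔ : Fin (2 * (suc d * (2 * 2) ^ n) + n * 2 ^ n) ↔ Choice
  Choice↔ = ↔-trans +↔⊎
    (↔-trans *↔× (2↔Bool ×-↔ ↔-trans *↔× (↔-refl ×-↔ Vec↔ n (↔-trans *↔× (2↔Bool ×-↔ 2↔Bool))))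
      ⊎-↔ ↔-trans *↔× (↔-refl ×-↔ Vec↔ n 2↔Bool))

  numCycles-≥ : 2 * (suc d * (2 * 2) ^ n) + n * 2 ^ n ≤ numCycles graph
  numCycles-≥ = injective⇒≤numCycles graph (cycle ∘ to) (to-injective ∘ cycle-injective) (cycle-isCycle ∘ to)
    where
    open Inverse Choice↔ using (to; from; strictlyInverseʳ)

    to-injective : Injective _≡_ _≡_ to
    to-injective {i} {j} eq = trans (sym (strictlyInverseʳ i)) (trans (cong from eq) (strictlyInverseʳ j))

  -- Connectedness and cyclomatic number.

  edge-path : ∀ e {u w} → ends e ≈ₚ (u , w) → Star Linked u w
  edge-path e p = (e , p) ◅ ε

  to-corner : ∀ v → Star Linked v (L (proj₁ v) false)
  to-corner (L g false)      = ε
  to-corner (R (suc g) p)    = edge-path (inner g false p) (inj₂ refl)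
  to-corner (L (suc g) true) = edge-path (inner g true true) (inj₁ refl) ◅◅ edge-path (inner g false true) (inj₂ refl)
  to-corner (L zero true)    = edge-path (rung zero) (inj₂ refl)
  to-corner (R zero false)   = edge-path (base false) (inj₂ refl)
  to-corner (R zero true)    = edge-path (base true) (inj₂ refl) ◅◅ edge-path (rung zero) (inj₂ refl)

  to-zero : ∀ g → Star Linked (L g false) (L zero false)
  to-zero = <-weakInduction (λ g → Star Linked (L g false) (L zero false)) ε λ g t →
    subst (λ h → Star Linked (L h false) (R (inject₁ g) false)) (next-inject₁ g)
      (edge-path (link (inject₁ g) false) (inj₁ refl))
      ◅◅ to-corner (R (inject₁ g) false) ◅◅ t

  connected : Connected graph
  connected = _ , linked⇒connected λ u w → rooted u ◅◅ reverse (λ (e , p) → e , ≈ₚ-trans p (inj₂ refl)) (rooted w)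
    where
    rooted : ∀ v → Star Linked v (L zero false)
    rooted v = to-corner v ◅◅ to-zero (proj₁ v)

  graph-cyclomatic : cyclomatic graph ≡ + (4 + (d + k * 2))
  graph-cyclomatic = trans (cong (λ s → (+ s -ℤ + order graph) +ℤ 1ℤ) sizes)
    (excess (order graph) (3 + (d + k * 2)))
    where
    sizes : size graph ≡ order graph + (3 + (d + k * 2))
    sizes = solve 2 (λ k d →
      (con 1 :+ k) :* con 4 :+ (con 2 :+ ((con 1 :+ d) :+ (con 2 :+ k) :* con 2))
        := (con 2 :+ k) :* con 4 :+ (con 3 :+ (d :+ k :* con 2))) refl k d
      where open +-*-Solver

-- Naturals as rationals and the cut of the square root.

-- The fraction in constructor form, on which arithmetic computes, whereas `fromℕ n` is stuck on a
-- gcd for variable `n`.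
whole : ℕ → ℚ
whole n = mkℚ (+ n) 0 (coprime-sym (1-coprimeTo n))

fromℕ-whole : ∀ n → fromℕ n ≡ whole n
fromℕ-whole n = ℚ.normalize-coprime (coprime-sym (1-coprimeTo n))

fromℕ-+ : ∀ m n → fromℕ (m + n) ≡ fromℕ m +ℚ fromℕ n
fromℕ-+ m n = trans (cong (_/ℚ 1) (sym (cong₂ _+ℤ_ (ℤ.*-identityʳ (+ m)) (ℤ.*-identityʳ (+ n)))))
  (sym (cong₂ _+ℚ_ (fromℕ-whole m) (fromℕ-whole n)))

fromℕ-* : ∀ m n → fromℕ (m * n) ≡ fromℕ m *ℚ fromℕ n
fromℕ-* m n = trans (cong (_/ℚ 1) (ℤ.pos-* m n)) (sym (cong₂ _*ℚ_ (fromℕ-whole m) (fromℕ-whole n)))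

fromℕ-mono-≤ : ∀ {m n} → m ≤ n → fromℕ m ≤ℚ fromℕ n
fromℕ-mono-≤ {m} {n} m≤n = subst₂ _≤ℚ_ (sym (fromℕ-whole m)) (sym (fromℕ-whole n))
  (*≤* (subst₂ _≤ℤ_ (sym (ℤ.*-identityʳ (+ m))) (sym (ℤ.*-identityʳ (+ n))) (+≤+ m≤n)))

fromℕ-nonNegative : ∀ n → NonNegativeℚ (fromℕ n)
fromℕ-nonNegative n = nonNegative (fromℕ-mono-≤ {0} {n} z≤n)

-- A `q` above `b` would satisfy `q * q ≥ b * b ≥ 2 ^ r`, contrary to its membership in the cut.
<2^/2⇒≤ : ∀ {q} b r → 2 ^ r ≤ b * b → q <2^[ r /2] → q ≤ℚ fromℕ b
<2^/2⇒≤ b r _ (inj₁ q<0) = ℚ.≤-trans (ℚ.<⇒≤ q<0) (fromℕ-mono-≤ {0} {b} z≤n)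
<2^/2⇒≤ {q} b r r≤ (inj₂ q²<) with fromℕ b ℚ.<? q
... | no b≮q  = ℚ.≮⇒≥ b≮q
... | yes b<q = ⊥-elim (ℚ.<-irrefl refl (begin-strict
  q *ℚ q               <⟨ q²< ⟩
  fromℕ (2 ^ r)        ≤⟨ fromℕ-mono-≤ r≤ ⟩
  fromℕ (b * b)        ≡⟨ fromℕ-* b b ⟩
  fromℕ b *ℚ fromℕ b  ≤⟨ ℚ.*-monoˡ-≤-nonNeg (fromℕ b) {{fromℕ-nonNegative b}} b≤q ⟩
  fromℕ b *ℚ q         ≤⟨ ℚ.*-monoʳ-≤-nonNeg q {{nonNegative (ℚ.≤-trans (fromℕ-mono-≤ {0} {b} z≤n) b≤q)}} b≤q ⟩
  q *ℚ q               ∎))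
  where
  open ℚ.≤-Reasoning
  b≤q = ℚ.<⇒≤ b<q

-- Numerical estimates and the final bound.

-- For `d ≤ 1` the number of rungs `suc d` equals `2 ^ d`, so the count is a single power of two,
-- with exponent `r - 1`.
winding-count : ∀ k d → d ≤ 1 → 2 * (suc d * (2 * 2) ^ suc k) ≡ 2 ^ (3 + (d + k * 2))
winding-count k d d≤1 = begin
  2 * (suc d * (4 * 4 ^ k))          ≡⟨ solve 2 (λ a b → con 2 :* (a :* (con 4 :* b)) := con 8 :* (a :* b)) refl
                                          (suc d) (4 ^ k) ⟩
  8 * (suc d * 4 ^ k)                ≡⟨ cong₂ (λ a b → 8 * (a * b)) (power d≤1)
                                          (trans (^-*-assoc 2 2 k) (cong (2 ^_) (*-comm 2 k))) ⟩
  8 * (2 ^ d * 2 ^ (k * 2))          ≡⟨ cong (8 *_) (sym (^-distribˡ-+-* 2 d (k * 2))) ⟩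
  8 * 2 ^ (d + k * 2)                ≡⟨ sym (^-distribˡ-+-* 2 3 (d + k * 2)) ⟩
  2 ^ (3 + (d + k * 2))              ∎
  where
  open ≡-Reasoning
  open +-*-Solver
  power : ∀ {d} → d ≤ 1 → suc d ≡ 2 ^ d
  power z≤n       = refl
  power (s≤s z≤n) = refl

-- The number 2 ^ (k + 3) bounds 2 ^ (r / 2) for r = 4 + (d + k * 2).
root-bound : ∀ k d → d ≤ 1 → 2 ^ (4 + (d + k * 2)) ≤ 2 ^ (3 + k) * 2 ^ (3 + k)
root-bound k d d≤1 = begin
  2 ^ (4 + (d + k * 2))        ≤⟨ ^-monoʳ-≤ 2 (+-monoʳ-≤ 4 (+-monoˡ-≤ (k * 2) (≤-trans d≤1 (n≤1+n 1)))) ⟩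
  2 ^ (4 + (2 + k * 2))        ≡⟨ cong (2 ^_) (solve 1 (λ k →
                                    con 4 :+ (con 2 :+ k :* con 2) := (con 3 :+ k) :+ (con 3 :+ k)) refl k) ⟩
  2 ^ ((3 + k) + (3 + k))      ≡⟨ ^-distribˡ-+-* 2 (3 + k) (3 + k) ⟩
  2 ^ (3 + k) * 2 ^ (3 + k)    ∎
  where
  open ≤-Reasoning
  open +-*-Solver

-- Here `r ≤ 5 * suc k` and `2 ^ (3 + k)` is `4 * 2 ^ suc k`; this gives the factor 20, whose
-- reciprocal is `c`.
doubling-count : ∀ k d → d ≤ 1 → (4 + (d + k * 2)) * 2 ^ (3 + k) ≤ 20 * (suc k * 2 ^ suc k)
doubling-count k d d≤1 = begin
  (4 + (d + k * 2)) * 2 ^ (3 + k)   ≤⟨ *-monoˡ-≤ (2 ^ (3 + k))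
                                         (+-monoʳ-≤ 4 (+-mono-≤ d≤1 (*-monoʳ-≤ k (s≤s (s≤s (z≤n {3})))))) ⟩
  (4 + (1 + k * 5)) * 2 ^ (3 + k)   ≡⟨ solve 2 (λ k a →
                                          (con 4 :+ (con 1 :+ k :* con 5)) :* (con 2 :* (con 2 :* (con 2 :* a)))
                                          := con 20 :* ((con 1 :+ k) :* (con 2 :* a))) refl k (2 ^ k) ⟩
  20 * (suc k * 2 ^ suc k)          ∎
  where
  open ≤-Reasoning
  open +-*-Solver

c : ℚ
c = + 1 /ℚ 20

cut-bound : ∀ a b r s {q Ψr} → q ≤ℚ fromℕ b → r * b ≤ 20 * s → a + s ≤ Ψr →
  fromℕ a +ℚ (c *ℚ fromℕ r) *ℚ q ≤ℚ fromℕ Ψr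
cut-bound a b r s {q} {Ψr} q≤b rb≤ a+s≤ = begin
  fromℕ a +ℚ (c *ℚ fromℕ r) *ℚ q           ≡⟨ cong (fromℕ a +ℚ_) (ℚ.*-assoc c (fromℕ r) q) ⟩
  fromℕ a +ℚ c *ℚ (fromℕ r *ℚ q)           ≤⟨ ℚ.+-monoʳ-≤ (fromℕ a) (ℚ.*-monoˡ-≤-nonNeg c
                                                (ℚ.*-monoˡ-≤-nonNeg (fromℕ r) {{fromℕ-nonNegative r}} q≤b)) ⟩
  fromℕ a +ℚ c *ℚ (fromℕ r *ℚ fromℕ b)    ≡⟨ cong (λ x → fromℕ a +ℚ c *ℚ x) (sym (fromℕ-* r b)) ⟩
  fromℕ a +ℚ c *ℚ fromℕ (r * b)            ≤⟨ ℚ.+-monoʳ-≤ (fromℕ a) (ℚ.*-monoˡ-≤-nonNeg c (fromℕ-mono-≤ rb≤)) ⟩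
  fromℕ a +ℚ c *ℚ fromℕ (20 * s)           ≡⟨ cong (λ x → fromℕ a +ℚ c *ℚ x) (fromℕ-* 20 s) ⟩
  fromℕ a +ℚ c *ℚ (fromℕ 20 *ℚ fromℕ s)   ≡⟨ cong (fromℕ a +ℚ_) (sym (ℚ.*-assoc c (fromℕ 20) (fromℕ s))) ⟩
  fromℕ a +ℚ 1ℚ *ℚ fromℕ s                 ≡⟨ cong (fromℕ a +ℚ_) (ℚ.*-identityˡ (fromℕ s)) ⟩
  fromℕ a +ℚ fromℕ s                        ≡⟨ sym (fromℕ-+ a s) ⟩
  fromℕ (a + s)                              ≤⟨ fromℕ-mono-≤ a+s≤ ⟩
  fromℕ Ψr                                   ∎
  where open ℚ.≤-Reasoning

bound : ∀ k d → d ≤ 1 → let r = 4 + (d + k * 2) in ∀ Ψr → IsΨ r Ψr → ∀ q → q <2^[ r /2] →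
  fromℕ (2 ^ (r ∸ 1)) +ℚ (c *ℚ fromℕ r) *ℚ q ≤ℚ fromℕ Ψr
bound k d d≤1 Ψr isΨ q q< =
  cut-bound (2 ^ (3 + (d + k * 2))) (2 ^ (3 + k)) (4 + (d + k * 2)) (suc k * 2 ^ suc k)
    (<2^/2⇒≤ (2 ^ (3 + k)) (4 + (d + k * 2)) (root-bound k d d≤1) q<) (doubling-count k d d≤1)
    (subst (λ a → a + suc k * 2 ^ suc k ≤ Ψr) (winding-count k d d≤1)
      (≤-trans numCycles-≥ (IsΨ.maximal isΨ graph connected graph-cyclomatic)))
  where open Necklace k d d≤1

theorem1p7 : ∃[ c ] (0ℚ <ℚ c) × (∃[ r₀ ] (∀ (r : ℕ) → r₀ ≤ r →
    ∀ (Ψr : ℕ) → IsΨ r Ψr →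
    ∀ (q : ℚ) → q <2^[ r /2] →
    fromℕ (2 ^ (r ∸ 1)) +ℚ (c *ℚ fromℕ r) *ℚ q ≤ℚ fromℕ Ψr))
theorem1p7 = c , ℚ.positive⁻¹ c , 4 , λ r 4≤r → subst Bounded (split r 4≤r)
    -- The threshold 4 is the cyclomatic number of the smallest ring, with `k` and `d` zero; in
    -- general they are the quotient and the remainder of `r ∸ 4` by 2.
    (bound ((r ∸ 4) / 2) ((r ∸ 4) % 2) (≤-pred (m%n<n (r ∸ 4) 2)))
  where
  Bounded : ℕ → Set
  Bounded r = ∀ Ψr → IsΨ r Ψr → ∀ q → q <2^[ r /2] →
    fromℕ (2 ^ (r ∸ 1)) +ℚ (c *ℚ fromℕ r) *ℚ q ≤ℚ fromℕ Ψr

  split : ∀ r → 4 ≤ r → 4 + ((r ∸ 4) % 2 + (r ∸ 4) / 2 * 2) ≡ r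
  split r 4≤r = trans (cong (λ s → 4 + s) (sym (m≡m%n+[m/n]*n (r ∸ 4) 2))) (m+[n∸m]≡n 4≤r)
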